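{- Let $n \ge 1$, let $G$ be any graph on the vertex set $[n]$, and let $w_G(0) \in \mathbb{Z}^n$ be any initial configuration. Then the sequence $(w_G(t))_{t \ge 0}$ of configurations of the diffusion process on $G$ started from $w_G(0)$ is eventually periodic with period either $1$ or $2$; that is, there exist $p \in \{1,2\}$ and an integer $T \ge 0$ such that $w_G(t+p) = w_G(t)$ for all integers $t \ge T$.
   Context: Graphs are finite, simple and undirected, and $[n] = \{1,2,\dots,n\}$. The diffusion process on a graph $G$ with vertex set $[n]$ from an initial configuration $w_G(0) = (w_1(0),\dots,w_n(0)) \in \mathbb{Z}^n$ is defined as follows. For each integer $t \ge 0$ and each vertex $v \in [n]$, let $A_v(t)$ be the number of neighbours $u$ of $v$ in $G$ with $w_u(t) > w_v(t)$, and let $B_v(t)$ be the number of neighbours $u$ of $v$ in $G$ with $w_u(t) < w_v(t)$. All labels are updated simultaneously by $$w_v(t+1) = w_v(t) + A_v(t) - B_v(t).$$ Write $w_G(t) = (w_1(t), w_2(t), \dots, w_n(t)) \in \mathbb{Z}^n$. (Labels may be negative.) -}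

module Defs where

open import Level using (0ℓ)
open import Data.Fin using (Fin)
open import Data.Integer using (ℤ; +_; _+_; _-_)
open import Data.Integer.Properties using (_<?_)
open import Data.Nat using (ℕ; zero; suc)
open import Data.Vec using (allFin; count)
open import Data.Vec.Functional using (Vector)
open import Relation.Binary.Core using (Rel)
open import Relation.Binary.Definitions using (Decidable; Irreflexive; Symmetric)
open import Relation.Binary.PropositionalEquality using (_≡_)
open import Relation.Nullary.Decidable using (_×-dec_)

-- Finite simple undirected graphs. Vertices are numbered 0, …, n - 1, and
-- adjacency is decidable so that neighbours can be counted.
record Graph (n : ℕ) : Set₁ where
  infix 4 _~_ _~?_
  field
    _~_      : Rel (Fin n) 0ℓ
    _~?_     : Decidable _~_
    ~-sym    : Symmetric _~_
    ~-irrefl : Irreflexive _≡_ _~_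

Configuration : ℕ → Set
Configuration n = Vector ℤ n

module _ {n : ℕ} (G : Graph n) where
  open Graph G

  #richer : Configuration n → Fin n → ℕ
  #richer w v = count (λ u → (v ~? u) ×-dec (w v <? w u)) (allFin n)

  #poorer : Configuration n → Fin n → ℕ
  #poorer w v = count (λ u → (v ~? u) ×-dec (w u <? w v)) (allFin n)

  step : Configuration n → Configuration n
  step w v = (w v + + #richer w v) - + #poorer w v

  diffusion : Configuration n → ℕ → Configuration n
  diffusion w₀ zero    = w₀
  diffusion w₀ (suc t) = step (diffusion w₀ t)

{-# OPTIONS --safe #-}
-- Let w, w′, w″ be successive configurations. The quantity Ψ(w) = 2 ∑ᵥ wᵥ w′ᵥ never increases:
-- symmetrising over ordered pairs, Ψ(w′) - Ψ(w) = ∑ᵥ ∑ᵤ (w′ᵥ - w′ᵤ) (f′ᵥᵤ + fᵥᵤ), where fᵥᵤ is the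
-- flow from u to v, and in each term f′ᵥᵤ has the sign opposite to w′ᵥ - w′ᵤ and dominates fᵥᵤ.
-- It is bounded below since 2xy ≥ - (y - x)² and labels change by at most n.
-- If Ψ does not drop, every edge either reverses its flow or becomes flat, so ∑ f² cannot
-- increase; if ∑ f² does not drop either, every flow is reversed and w″ = w. Hence (Ψ, ∑ f²)
-- decreases lexicographically until the configuration recurs with period 2.
module Submission where

open import Defs
open import Data.Bool using (if_then_else_; true; false)
open import Data.Empty using (⊥-elim)
open import Data.Fin using (Fin; zero; suc)
open import Data.Integer as ℤ using (ℤ; 0ℤ; 1ℤ; -1ℤ; +_; -[1+_]; -_; ∣_∣; +≤+; -≤+; +<+)
import Data.Integer.Properties as ℤ
open import Data.Integer.Solver using (module +-*-Solver)
open import Data.Nat using (ℕ; zero; suc; _+_; _≥_)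
import Data.Nat as ℕ
open import Data.Nat.Induction using (<-wellFounded)
import Data.Nat.Properties as ℕ
open import Data.Product using (∃-syntax; _×_; _,_)
open import Data.Product.Relation.Binary.Lex.Strict using (×-Lex; ×-wellFounded)
open import Data.Sum as Sum using (_⊎_; inj₁; inj₂)
open import Data.Vec using (allFin; count; tabulate)
open import Data.Vec.Functional using (Vector)
open import Data.Vec.Properties using (count≤n)
open import Function using (id; _∘_; _on_)
open import Induction.WellFounded using (Acc; acc; WellFounded)
import Relation.Binary.Construct.On as On
open import Relation.Binary.Definitions using (tri<; tri≈; tri>)
open import Relation.Binary.PropositionalEquality using (_≡_; _≗_; refl; sym; trans; cong; cong₂; subst; module ≡-Reasoning)
open import Relation.Nullary using (Dec; yes; no; does)
open import Relation.Nullary.Decidable using (_×-dec_; dec-true; dec-false)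
open import Relation.Unary using (Pred; Decidable)

open import Algebra.Properties.Semiring.Sum ℤ.+-*-semiring using (sum; sum-syntax; sum-cong-≗; ∑-distrib-+; ∑-comm; *-distribˡ-sum; sum-replicate-zero)
open +-*-Solver using (solve; _:=_; _:+_; _:*_; :-_; _:-_)

-- Integer inequalities and finite sums.

i*i≡∣i∣*∣i∣ : ∀ i → i ℤ.* i ≡ + ∣ i ∣ ℤ.* + ∣ i ∣
i*i≡∣i∣*∣i∣ (+ _)    = refl
i*i≡∣i∣*∣i∣ -[1+ _ ] = refl

0≤i*i : ∀ i → 0ℤ ℤ.≤ i ℤ.* i
0≤i*i i = subst (0ℤ ℤ.≤_) (sym (trans (i*i≡∣i∣*∣i∣ i) (sym (ℤ.pos-* ∣ i ∣ ∣ i ∣)))) (+≤+ ℕ.z≤n)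

∣i∣≤n⇒i*i≤n*n : ∀ i {n} → ∣ i ∣ ℕ.≤ n → i ℤ.* i ℤ.≤ + n ℤ.* + n
∣i∣≤n⇒i*i≤n*n i {n} ∣i∣≤n = begin
  i ℤ.* i                ≡⟨ i*i≡∣i∣*∣i∣ i ⟩
  + ∣ i ∣ ℤ.* + ∣ i ∣    ≡⟨ ℤ.pos-* ∣ i ∣ ∣ i ∣ ⟨
  + (∣ i ∣ ℕ.* ∣ i ∣)    ≤⟨ +≤+ (ℕ.*-mono-≤ ∣i∣≤n ∣i∣≤n) ⟩
  + (n ℕ.* n)            ≡⟨ ℤ.pos-* n n ⟩
  + n ℤ.* + n            ∎
  where open ℤ.≤-Reasoning

0≤i<j⇒∣i∣<∣j∣ : ∀ {i j} → 0ℤ ℤ.≤ i → i ℤ.< j → ∣ i ∣ ℕ.< ∣ j ∣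
0≤i<j⇒∣i∣<∣j∣ (+≤+ _) (+<+ i<j) = i<j

∣m-n∣≤m⊔n : ∀ m n → ∣ + m ℤ.- + n ∣ ℕ.≤ m ℕ.⊔ n
∣m-n∣≤m⊔n m n = subst (λ i → ∣ i ∣ ℕ.≤ m ℕ.⊔ n) (sym (ℤ.m-n≡m⊖n m n)) (ℤ.∣m⊝n∣≤m⊔n m n)

sum-neg : ∀ {n} (f : Vector ℤ n) → ∑[ i < n ] (- f i) ≡ - sum f
sum-neg {zero}  f = refl
sum-neg {suc n} f = trans (cong (ℤ._+_ (- f zero)) (sum-neg (f ∘ suc))) (sym (ℤ.neg-distrib-+ (f zero) _))

sum-nonNeg : ∀ {n} (f : Vector ℤ n) → (∀ i → 0ℤ ℤ.≤ f i) → 0ℤ ℤ.≤ sum f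
sum-nonNeg {zero}  f 0≤f = ℤ.≤-refl
sum-nonNeg {suc n} f 0≤f = ℤ.+-mono-≤ (0≤f zero) (sum-nonNeg (f ∘ suc) (0≤f ∘ suc))

-- A single strict term already makes the sum strict, so a tie between the sums forces equality in
-- every term. Its double-sum form supplies both levels of the lexicographic descent.
sum-mono-<⊎≗ : ∀ {n} (f g : Vector ℤ n) → (∀ i → f i ℤ.≤ g i) → sum f ℤ.< sum g ⊎ f ≗ g
sum-mono-<⊎≗ {zero}  f g f≤g = inj₂ λ ()
sum-mono-<⊎≗ {suc n} f g f≤g with sum-mono-<⊎≗ (f ∘ suc) (g ∘ suc) (f≤g ∘ suc) | f zero ℤ.≟ g zero
... | inj₁ lt | _       = inj₁ (ℤ.+-mono-≤-< (f≤g zero) lt)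
... | inj₂ eq | yes eq₀ = inj₂ λ { zero → eq₀ ; (suc i) → eq i }
... | inj₂ eq | no ≢₀   = inj₁ (ℤ.+-mono-<-≤ (ℤ.≤∧≢⇒< (f≤g zero) ≢₀) (ℤ.≤-reflexive (sum-cong-≗ eq)))

sum²-mono-<⊎≡ : ∀ {m n} (f g : Fin m → Fin n → ℤ) → (∀ i j → f i j ℤ.≤ g i j) →
  ∑[ i < m ] sum (f i) ℤ.< ∑[ i < m ] sum (g i) ⊎ (∀ i j → f i j ≡ g i j)
sum²-mono-<⊎≡ f g f≤g with sum-mono-<⊎≗ (sum ∘ f) (sum ∘ g) row-≤
  where
  row-≤ : ∀ i → sum (f i) ℤ.≤ sum (g i)
  row-≤ i with sum-mono-<⊎≗ (f i) (g i) (f≤g i)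
  ... | inj₁ lt = ℤ.<⇒≤ lt
  ... | inj₂ eq = ℤ.≤-reflexive (sum-cong-≗ eq)
... | inj₁ lt   = inj₁ lt
... | inj₂ rows = inj₂ row-≡
  where
  row-≡ : ∀ i → f i ≗ g i
  row-≡ i with sum-mono-<⊎≗ (f i) (g i) (f≤g i)
  ... | inj₁ lt = ⊥-elim (ℤ.<-irrefl (rows i) lt)
  ... | inj₂ eq = eq

sum²-zero : ∀ m n → ∑[ i < m ] ∑[ j < n ] 0ℤ ≡ 0ℤ
sum²-zero m n = trans (sum-cong-≗ {m} λ _ → sum-replicate-zero n) (sum-replicate-zero m)

-- Summation by parts: antisymmetry turns `- x u * g v u` into `x u * g u v`, and exchanging the
-- order of summation makes this half a second copy of the other.
sum²-antisym : ∀ {n} (x : Vector ℤ n) (g : Fin n → Fin n → ℤ) → (∀ v u → g u v ≡ - g v u) →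
  ∑[ v < n ] ∑[ u < n ] ((x v ℤ.- x u) ℤ.* g v u) ≡
  ∑[ v < n ] (x v ℤ.* sum (g v)) ℤ.+ ∑[ v < n ] (x v ℤ.* sum (g v))
sum²-antisym {n} x g anti = begin
  ∑[ v < n ] ∑[ u < n ] ((x v ℤ.- x u) ℤ.* g v u)
    ≡⟨ sum-cong-≗ (λ v → sum-cong-≗ (split v)) ⟩
  ∑[ v < n ] ∑[ u < n ] (x v ℤ.* g v u ℤ.+ x u ℤ.* g u v)
    ≡⟨ sum-cong-≗ (λ v → ∑-distrib-+ (λ u → x v ℤ.* g v u) (λ u → x u ℤ.* g u v)) ⟩
  ∑[ v < n ] (∑[ u < n ] (x v ℤ.* g v u) ℤ.+ ∑[ u < n ] (x u ℤ.* g u v))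
    ≡⟨ ∑-distrib-+ (λ v → ∑[ u < n ] (x v ℤ.* g v u)) (λ v → ∑[ u < n ] (x u ℤ.* g u v)) ⟩
  ∑[ v < n ] ∑[ u < n ] (x v ℤ.* g v u) ℤ.+ ∑[ v < n ] ∑[ u < n ] (x u ℤ.* g u v)
    ≡⟨ cong (ℤ._+_ S) (∑-comm (λ v u → x u ℤ.* g u v)) ⟩
  S ℤ.+ S
    ≡⟨ cong₂ ℤ._+_ S≡ S≡ ⟩
  ∑[ v < n ] (x v ℤ.* sum (g v)) ℤ.+ ∑[ v < n ] (x v ℤ.* sum (g v)) ∎
  where
  open ≡-Reasoning
  S : ℤ
  S = ∑[ v < n ] ∑[ u < n ] (x v ℤ.* g v u)
  S≡ : S ≡ ∑[ v < n ] (x v ℤ.* sum (g v))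
  S≡ = sum-cong-≗ λ v → sym (*-distribˡ-sum (x v) (g v))
  split : ∀ v u → (x v ℤ.- x u) ℤ.* g v u ≡ x v ℤ.* g v u ℤ.+ x u ℤ.* g u v
  split v u rewrite anti v u =
    solve 3 (λ a b c → (a :- b) :* c := a :* c :+ b :* (:- c)) refl (x v) (x u) (g v u)

-- Flow along a single edge.

indicator : ∀ {p} {P : Set p} → Dec P → ℤ
indicator P? = if does P? then 1ℤ else 0ℤ

count-tabulate : ∀ {a p} {A : Set a} {P : Pred A p} (P? : Decidable P) {n} (f : Fin n → A) →
  + count P? (tabulate f) ≡ ∑[ i < n ] indicator (P? (f i))
count-tabulate P? {zero}  f = refl
count-tabulate P? {suc n} f with does (P? (f zero))
... | true  = trans (ℤ.pos-+ 1 _) (cong (ℤ._+_ 1ℤ) (count-tabulate P? (f ∘ suc)))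
... | false = trans (count-tabulate P? (f ∘ suc)) (sym (ℤ.+-identityˡ _))

-- What a vertex labelled x receives from a vertex labelled y.
flow : ∀ {a} {A : Set a} → Dec A → ℤ → ℤ → ℤ
flow a? x y = indicator (a? ×-dec (x ℤ.<? y)) ℤ.- indicator (a? ×-dec (y ℤ.<? x))

module _ {a} {A : Set a} where

  flow-refl : ∀ (a? : Dec A) x → flow a? x x ≡ 0ℤ
  flow-refl a? x = ℤ.+-inverseʳ (indicator (a? ×-dec (x ℤ.<? x)))

  flow-< : ∀ {p : A} {x y} → x ℤ.< y → flow (yes p) x y ≡ 1ℤ
  flow-< {x = x} {y} x<y
    rewrite dec-true (x ℤ.<? y) x<y | dec-false (y ℤ.<? x) (ℤ.<-asym x<y) = refl

  flow-> : ∀ {p : A} {x y} → y ℤ.< x → flow (yes p) x y ≡ -1ℤ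
  flow-> {x = x} {y} y<x
    rewrite dec-true (y ℤ.<? x) y<x | dec-false (x ℤ.<? y) (ℤ.<-asym y<x) = refl

  -1≤flow : ∀ (a? : Dec A) x y → -1ℤ ℤ.≤ flow a? x y
  -1≤flow a? x y with does (a? ×-dec (x ℤ.<? y)) | does (a? ×-dec (y ℤ.<? x))
  ... | true  | true  = -≤+
  ... | true  | false = -≤+
  ... | false | true  = ℤ.≤-refl
  ... | false | false = -≤+

  flow≤1 : ∀ (a? : Dec A) x y → flow a? x y ℤ.≤ 1ℤ
  flow≤1 a? x y with does (a? ×-dec (x ℤ.<? y)) | does (a? ×-dec (y ℤ.<? x))
  ... | true  | true  = +≤+ ℕ.z≤n
  ... | true  | false = ℤ.≤-refl
  ... | false | true  = -≤+
  ... | false | false = +≤+ ℕ.z≤n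

  -- If `x′ < y′`, the new flow is 1; the old one is at least -1, so the sum is nonnegative while
  -- `x′ - y′` is negative. The case `y′ < x′` is the mirror image. No relation between old and new
  -- labels enters.
  flow-dissipates : ∀ (a? : Dec A) x y x′ y′ →
    (x′ ℤ.- y′) ℤ.* (flow a? x′ y′ ℤ.+ flow a? x y) ℤ.≤ 0ℤ
  flow-dissipates (no ¬a)    x y x′ y′ = ℤ.≤-reflexive (ℤ.*-zeroʳ (x′ ℤ.- y′))
  flow-dissipates a?@(yes p) x y x′ y′ with ℤ.<-cmp x′ y′
  ... | tri< x′<y′ _ _ rewrite flow-< {p} x′<y′ =
    ℤ.*-monoʳ-≤-nonNeg (1ℤ ℤ.+ flow a? x y)
      {{ℤ.nonNegative (ℤ.+-monoʳ-≤ 1ℤ (-1≤flow a? x y))}} (ℤ.i≤j⇒i-j≤0 (ℤ.<⇒≤ x′<y′))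
  ... | tri≈ _ refl _ rewrite ℤ.+-inverseʳ x′ = ℤ.≤-refl
  ... | tri> _ _ y′<x′ rewrite flow-> {p} y′<x′ =
    subst ((x′ ℤ.- y′) ℤ.* (-1ℤ ℤ.+ flow a? x y) ℤ.≤_) (ℤ.*-zeroʳ (x′ ℤ.- y′))
      (ℤ.*-monoˡ-≤-nonNeg (x′ ℤ.- y′) {{ℤ.nonNegative (ℤ.i≤j⇒0≤j-i (ℤ.<⇒≤ y′<x′))}}
        (ℤ.+-monoʳ-≤ -1ℤ (flow≤1 a? x y)))

  flow-flat-or-reversed : ∀ (a? : Dec A) x y x′ y′ →
    (x′ ℤ.- y′) ℤ.* (flow a? x′ y′ ℤ.+ flow a? x y) ≡ 0ℤ →
    flow a? x′ y′ ≡ 0ℤ ⊎ flow a? x′ y′ ≡ - flow a? x y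
  flow-flat-or-reversed a? x y x′ y′ eq with ℤ.i*j≡0⇒i≡0∨j≡0 (x′ ℤ.- y′) eq
  ... | inj₁ x′-y′≡0 rewrite ℤ.i-j≡0⇒i≡j x′ y′ x′-y′≡0 = inj₁ (flow-refl a? y′)
  ... | inj₂ sum≡0 = inj₂ (ℤ.i-j≡0⇒i≡j _ _
    (trans (cong (ℤ._+_ (flow a? x′ y′)) (ℤ.neg-involutive (flow a? x y))) sum≡0))

-- The two directions of an edge are decided by separate calls of `_~?_`, hence two decisions; the
-- implications exclude conflicting answers.
flow-antisym : ∀ {a b} {A : Set a} {B : Set b} → (A → B) → (B → A) → (a? : Dec A) (b? : Dec B) →
  ∀ x y → flow b? y x ≡ - flow a? x y
flow-antisym to from (yes _) (yes _) x y with does (x ℤ.<? y) | does (y ℤ.<? x)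
... | true  | true  = refl
... | true  | false = refl
... | false | true  = refl
... | false | false = refl
flow-antisym to from (yes p) (no ¬b) x y = ⊥-elim (¬b (to p))
flow-antisym to from (no ¬a) (yes q) x y = ⊥-elim (¬a (from q))
flow-antisym to from (no _)  (no _)  x y = refl

-- Algebra of two successive steps.

module _ {f f′ : ℤ} where

  square-nonincreasing : f′ ≡ 0ℤ ⊎ f′ ≡ - f → f′ ℤ.* f′ ℤ.≤ f ℤ.* f
  square-nonincreasing (inj₁ refl) = 0≤i*i f
  square-nonincreasing (inj₂ refl) =
    ℤ.≤-reflexive (solve 1 (λ a → :- a :* :- a := a :* a) refl f)

  -- A flow that has become flat keeps its square only if it was zero before, and then it too counts
  -- as reversed.
  square-preserved : f′ ≡ 0ℤ ⊎ f′ ≡ - f → f′ ℤ.* f′ ≡ f ℤ.* f → f′ ℤ.+ f ≡ 0ℤ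
  square-preserved (inj₂ refl) _  = ℤ.+-inverseˡ f
  square-preserved (inj₁ refl) eq with ℤ.i*j≡0⇒i≡0∨j≡0 f (sym eq)
  ... | inj₁ refl = refl
  ... | inj₂ refl = refl

-- Both products share the factor `x′`, so their difference is `x′ * (x″ - x)`, and `x″ - x` is
-- `d′ + d`.
product-increment : ∀ x {x′ x″ d d′ s} m → x′ ≡ x ℤ.+ d → x″ ≡ x′ ℤ.+ d′ → s ≡ d′ ℤ.+ d →
  x′ ℤ.* x″ ℤ.+ x′ ℤ.* x″ ℤ.+ m ≡ x ℤ.* x′ ℤ.+ x ℤ.* x′ ℤ.+ m ℤ.+ (x′ ℤ.* s ℤ.+ x′ ℤ.* s)
product-increment x {d = d} {d′} m refl refl refl =
  solve 4 (λ x d d′ m →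
    (x :+ d) :* ((x :+ d) :+ d′) :+ (x :+ d) :* ((x :+ d) :+ d′) :+ m
    := (x :* (x :+ d) :+ x :* (x :+ d) :+ m) :+ ((x :+ d) :* (d′ :+ d) :+ (x :+ d) :* (d′ :+ d)))
    refl x d d′ m

-- Drift, potential and activity of a configuration.

module _ {n : ℕ} (G : Graph n) where
  open Graph G

  edgeFlow : Configuration n → Fin n → Fin n → ℤ
  edgeFlow w v u = flow (v ~? u) (w v) (w u)

  drift : Configuration n → Fin n → ℤ
  drift w v = sum (edgeFlow w v)

  edgeFlow-antisym : ∀ w v u → edgeFlow w u v ≡ - edgeFlow w v u
  edgeFlow-antisym w v u = flow-antisym ~-sym ~-sym (v ~? u) (u ~? v) (w v) (w u)

  drift≡#richer-#poorer : ∀ w v → drift w v ≡ + #richer G w v ℤ.- + #poorer G w v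
  drift≡#richer-#poorer w v = begin
    drift w v
      ≡⟨ ∑-distrib-+ (indicator ∘ richer?) (-_ ∘ indicator ∘ poorer?) ⟩
    sum (indicator ∘ richer?) ℤ.+ ∑[ u < n ] (- indicator (poorer? u))
      ≡⟨ cong₂ ℤ._+_ (sym (count-tabulate richer? id))
           (trans (sum-neg (indicator ∘ poorer?)) (cong -_ (sym (count-tabulate poorer? id)))) ⟩
    + #richer G w v ℤ.- + #poorer G w v ∎
    where
    open ≡-Reasoning
    richer? : Decidable (λ u → v ~ u × w v ℤ.< w u)
    richer? u = (v ~? u) ×-dec (w v ℤ.<? w u)
    poorer? : Decidable (λ u → v ~ u × w u ℤ.< w v)
    poorer? u = (v ~? u) ×-dec (w u ℤ.<? w v)

  step≡+drift : ∀ w v → step G w v ≡ w v ℤ.+ drift w v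
  step≡+drift w v = trans (ℤ.+-assoc (w v) _ _) (cong (ℤ._+_ (w v)) (sym (drift≡#richer-#poorer w v)))

  ∣drift∣≤n : ∀ w v → ∣ drift w v ∣ ℕ.≤ n
  ∣drift∣≤n w v rewrite drift≡#richer-#poorer w v =
    -- Bounding the difference of two counts by their maximum, not their sum, gives the constant
    -- `n`.
    ℕ.≤-trans (∣m-n∣≤m⊔n (#richer G w v) (#poorer G w v))
      (ℕ.⊔-lub (count≤n _ (allFin n)) (count≤n _ (allFin n)))

  step-cong : ∀ {w w′} → w ≗ w′ → step G w ≗ step G w′
  step-cong {w} {w′} eq v = begin
    step G w v             ≡⟨ step≡+drift w v ⟩
    w v ℤ.+ drift w v      ≡⟨ cong₂ ℤ._+_ (eq v) (sum-cong-≗ λ u → cong₂ (flow (v ~? u)) (eq v) (eq u)) ⟩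
    w′ v ℤ.+ drift w′ v    ≡⟨ step≡+drift w′ v ⟨
    step G w′ v            ∎
    where open ≡-Reasoning

  -- The constant n² per vertex makes the potential nonnegative.
  potentialAt : Configuration n → Fin n → ℤ
  potentialAt w v = w v ℤ.* step G w v ℤ.+ w v ℤ.* step G w v ℤ.+ + n ℤ.* + n

  potential : Configuration n → ℤ
  potential w = sum (potentialAt w)

  activity : Configuration n → ℤ
  activity w = ∑[ v < n ] ∑[ u < n ] (edgeFlow w v u ℤ.* edgeFlow w v u)

  -- With `d` the drift at a vertex labelled `x`, `2x(x + d)` equals `x² + (x + d)² - d²`, and `d²`
  -- is at most `n²`.
  potential-nonNeg : ∀ w → 0ℤ ℤ.≤ potential w
  potential-nonNeg w = sum-nonNeg (potentialAt w) λ v → subst (0ℤ ℤ.≤_) (sym (square-form v))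
    (ℤ.+-mono-≤ (ℤ.+-mono-≤ (0≤i*i (w v)) (0≤i*i (w v ℤ.+ drift w v)))
      (ℤ.i≤j⇒0≤j-i (∣i∣≤n⇒i*i≤n*n (drift w v) (∣drift∣≤n w v))))
    where
    square-form : ∀ v → potentialAt w v ≡ w v ℤ.* w v ℤ.+ (w v ℤ.+ drift w v) ℤ.* (w v ℤ.+ drift w v)
                                          ℤ.+ (+ n ℤ.* + n ℤ.- drift w v ℤ.* drift w v)
    square-form v rewrite step≡+drift w v =
      solve 3 (λ x d m → x :* (x :+ d) :+ x :* (x :+ d) :+ m
                 := x :* x :+ (x :+ d) :* (x :+ d) :+ (m :- d :* d))
        refl (w v) (drift w v) (+ n ℤ.* + n)

  activity-nonNeg : ∀ w → 0ℤ ℤ.≤ activity w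
  activity-nonNeg w = sum-nonNeg _ λ v → sum-nonNeg _ λ u → 0≤i*i (edgeFlow w v u)

  -- Change of potential and activity in one step.

  module _ (w : Configuration n) where

    private
      w′ : Configuration n
      w′ = step G w

    flowSum : Fin n → Fin n → ℤ
    flowSum v u = edgeFlow w′ v u ℤ.+ edgeFlow w v u

    dissipation : Fin n → Fin n → ℤ
    dissipation v u = (w′ v ℤ.- w′ u) ℤ.* flowSum v u

    flowSum-antisym : ∀ v u → flowSum u v ≡ - flowSum v u
    flowSum-antisym v u = trans (cong₂ ℤ._+_ (edgeFlow-antisym w′ v u) (edgeFlow-antisym w v u))
      (sym (ℤ.neg-distrib-+ (edgeFlow w′ v u) (edgeFlow w v u)))

    sum-flowSum : ∀ v → sum (flowSum v) ≡ drift w′ v ℤ.+ drift w v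
    sum-flowSum v = ∑-distrib-+ (edgeFlow w′ v) (edgeFlow w v)

    -- The potential carries each product twice, so its increment is the pair of equal sums that
    -- symmetrising over ordered pairs produces.
    potential-step : potential w′ ≡ potential w ℤ.+ ∑[ v < n ] sum (dissipation v)
    potential-step = begin
      potential w′
        ≡⟨ sum-cong-≗ pointwise ⟩
      ∑[ v < n ] (potentialAt w v ℤ.+ (gain v ℤ.+ gain v))
        ≡⟨ ∑-distrib-+ (potentialAt w) (λ v → gain v ℤ.+ gain v) ⟩
      potential w ℤ.+ ∑[ v < n ] (gain v ℤ.+ gain v)
        ≡⟨ cong (ℤ._+_ (potential w)) (∑-distrib-+ gain gain) ⟩
      potential w ℤ.+ (sum gain ℤ.+ sum gain)
        ≡⟨ cong (ℤ._+_ (potential w)) (sum²-antisym w′ flowSum flowSum-antisym) ⟨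
      potential w ℤ.+ ∑[ v < n ] sum (dissipation v) ∎
      where
      open ≡-Reasoning
      gain : Fin n → ℤ
      gain v = w′ v ℤ.* sum (flowSum v)
      pointwise : ∀ v → potentialAt w′ v ≡ potentialAt w v ℤ.+ (gain v ℤ.+ gain v)
      pointwise v = product-increment (w v) (+ n ℤ.* + n) (step≡+drift w v) (step≡+drift w′ v) (sum-flowSum v)

    potential-decreases : potential w′ ℤ.< potential w ⊎
      (potential w′ ≡ potential w × (∀ v u → dissipation v u ≡ 0ℤ))
    potential-decreases with sum²-mono-<⊎≡ dissipation (λ _ _ → 0ℤ)
      (λ v u → flow-dissipates (v ~? u) (w v) (w u) (w′ v) (w′ u))
    ... | inj₁ lt = inj₁ (begin-strict
      potential w′                                      ≡⟨ potential-step ⟩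
      potential w ℤ.+ ∑[ v < n ] sum (dissipation v)    <⟨ ℤ.+-monoʳ-< (potential w) lt ⟩
      potential w ℤ.+ ∑[ v < n ] ∑[ u < n ] 0ℤ          ≡⟨ cong (ℤ._+_ (potential w)) (sum²-zero n n) ⟩
      potential w ℤ.+ 0ℤ                                ≡⟨ ℤ.+-identityʳ _ ⟩
      potential w                                       ∎)
      where open ℤ.≤-Reasoning
    ... | inj₂ eq = inj₂ ((begin
      potential w′                                      ≡⟨ potential-step ⟩
      potential w ℤ.+ ∑[ v < n ] sum (dissipation v)    ≡⟨ cong (ℤ._+_ (potential w)) (sum-cong-≗ λ v → sum-cong-≗ (eq v)) ⟩
      potential w ℤ.+ ∑[ v < n ] ∑[ u < n ] 0ℤ          ≡⟨ cong (ℤ._+_ (potential w)) (sum²-zero n n) ⟩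
      potential w ℤ.+ 0ℤ                                ≡⟨ ℤ.+-identityʳ _ ⟩
      potential w                                       ∎) , eq)
      where open ≡-Reasoning

    activity-decreases : (∀ v u → dissipation v u ≡ 0ℤ) →
      activity w′ ℤ.< activity w ⊎ (∀ v u → flowSum v u ≡ 0ℤ)
    activity-decreases no-dissipation =
      Sum.map₂ (λ eq v u → square-preserved (flat-or-reversed v u) (eq v u))
        (sum²-mono-<⊎≡ _ _ λ v u → square-nonincreasing (flat-or-reversed v u))
      where
      flat-or-reversed : ∀ v u → edgeFlow w′ v u ≡ 0ℤ ⊎ edgeFlow w′ v u ≡ - edgeFlow w v u
      flat-or-reversed v u =
        flow-flat-or-reversed (v ~? u) (w v) (w u) (w′ v) (w′ u) (no-dissipation v u)

    -- Over two steps the label of `v` changes by the sum of `flowSum v`.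
    flowSum≡0⇒2-periodic : (∀ v u → flowSum v u ≡ 0ℤ) → step G w′ ≗ w
    flowSum≡0⇒2-periodic eq v = begin
      step G w′ v                                ≡⟨ step≡+drift w′ v ⟩
      w′ v ℤ.+ drift w′ v                        ≡⟨ cong (ℤ._+ drift w′ v) (step≡+drift w v) ⟩
      w v ℤ.+ drift w v ℤ.+ drift w′ v           ≡⟨ solve 3 (λ x d d′ → x :+ d :+ d′ := x :+ (d′ :+ d)) refl (w v) (drift w v) (drift w′ v) ⟩
      w v ℤ.+ (drift w′ v ℤ.+ drift w v)         ≡⟨ cong (ℤ._+_ (w v)) (sum-flowSum v) ⟨
      w v ℤ.+ sum (flowSum v)                    ≡⟨ cong (ℤ._+_ (w v)) (trans (sum-cong-≗ (eq v)) (sum-replicate-zero n)) ⟩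
      w v ℤ.+ 0ℤ                                 ≡⟨ ℤ.+-identityʳ _ ⟩
      w v                                        ∎
      where open ≡-Reasoning

  -- Lexicographic descent and periodicity.

  measure : Configuration n → ℕ × ℕ
  measure w = ∣ potential w ∣ , ∣ activity w ∣

  infix 4 _≺_
  _≺_ : Configuration n → Configuration n → Set
  _≺_ = ×-Lex _≡_ ℕ._<_ ℕ._<_ on measure

  ≺-wellFounded : WellFounded _≺_
  ≺-wellFounded = On.wellFounded measure (×-wellFounded <-wellFounded <-wellFounded)

  -- Potential and activity are nonnegative, so a strict drop in ℤ survives passing to absolute
  -- values in ℕ.
  step-≺⊎2-periodic : ∀ w → step G w ≺ w ⊎ step G (step G w) ≗ w
  step-≺⊎2-periodic w with potential-decreases w
  ... | inj₁ lt = inj₁ (inj₁ (0≤i<j⇒∣i∣<∣j∣ (potential-nonNeg (step G w)) lt))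
  ... | inj₂ (eq , no-dissipation) with activity-decreases w no-dissipation
  ...   | inj₁ lt       = inj₁ (inj₂ (cong ∣_∣ eq , 0≤i<j⇒∣i∣<∣j∣ (activity-nonNeg (step G w)) lt))
  ...   | inj₂ reversed = inj₂ (flowSum≡0⇒2-periodic w reversed)

  module _ (w₀ : Configuration n) where

    eventually-2-periodic : ∃[ T ] diffusion G w₀ (2 + T) ≗ diffusion G w₀ T
    eventually-2-periodic = from 0 (≺-wellFounded w₀)
      where
      from : ∀ t → Acc _≺_ (diffusion G w₀ t) → ∃[ T ] diffusion G w₀ (2 + T) ≗ diffusion G w₀ T
      from t (acc rs) with step-≺⊎2-periodic (diffusion G w₀ t)
      ... | inj₁ step≺ = from (suc t) (rs step≺)
      -- The witness is the first time at which the descent offers no smaller configuration.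
      ... | inj₂ eq    = t , eq

    2-periodic-persists : ∀ {T} → diffusion G w₀ (2 + T) ≗ diffusion G w₀ T →
      ∀ k → diffusion G w₀ (2 + (k + T)) ≗ diffusion G w₀ (k + T)
    2-periodic-persists eq zero    = eq
    2-periodic-persists eq (suc k) = step-cong (2-periodic-persists eq k)

theorem1p1 : ∀ (n : ℕ) → n ≥ 1 → (G : Graph n) (w₀ : Configuration n) →
    ∃[ p ] ((p ≡ 1 ⊎ p ≡ 2) ×
    (∃[ T ] (∀ (t : ℕ) → t ≥ T → diffusion G w₀ (t + p) ≗ diffusion G w₀ t)))
theorem1p1 n _ G w₀ with eventually-2-periodic G w₀
-- The choice `p = 2` covers fixed points as well, since a constant tail also repeats after two
-- steps.
... | T , eq = 2 , inj₂ refl , T , λ t t≥T v → begin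
  diffusion G w₀ (t + 2) v              ≡⟨ cong (λ s → diffusion G w₀ s v) (ℕ.+-comm t 2) ⟩
  diffusion G w₀ (2 + t) v              ≡⟨ cong (λ s → diffusion G w₀ (2 + s) v) (ℕ.m∸n+n≡m t≥T) ⟨
  diffusion G w₀ (2 + (t ℕ.∸ T + T)) v  ≡⟨ 2-periodic-persists G w₀ eq (t ℕ.∸ T) v ⟩
  diffusion G w₀ (t ℕ.∸ T + T) v        ≡⟨ cong (λ s → diffusion G w₀ s v) (ℕ.m∸n+n≡m t≥T) ⟩
  diffusion G w₀ t v                    ∎
  where open ≡-Reasoning
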